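{- Let $P$ be a combinatorially symmetric row-stochastic $S\times S$ matrix (the transition matrix of a discrete-time homogeneous Markov chain) whose graph $\mathcal{G}(P)$ is connected, and let $Z\subseteq\{1,\ldots,S\}$ be a set of observed states that is a zero forcing set of $\mathcal{G}(P)$. Then the Markov chain is uniquely determined by the dynamics of the observed states. That is, if $P'$ is any combinatorially symmetric row-stochastic $S\times S$ matrix with $\mathcal{G}(P')=\mathcal{G}(P)$ and $(P'^n)_{ij}=(P^n)_{ij}$ for all $i,j\in Z$ and all $n\in\mathbb{N}$, then $P'=P$.
   Context: Markov chains are homogeneous and finite with states $1,\ldots,S$. A discrete-time chain has a transition matrix $P$ with real entries $(P)_{ij}\ge 0$, where $(P)_{ij}=\mathbb{P}(X_{n+1}=j\mid X_n=i)$, and $P$ is row stochastic: $\sum_{j=1}^S (P)_{ij}=1$ for all $i$. A matrix $M$ is combinatorially symmetric if for all indices $i,j$, $(M)_{ij}\neq 0$ implies $(M)_{ji}\neq 0$. For a combinatorially symmetric matrix $M$ of order $S$, $\mathcal{G}(M)$ is the simple undirected graph on the vertices $1,\ldots,S$ in which $\{i,j\}$ with $i<j$ is an edge if and only if $(M)_{ij}\neq 0$ (diagonal entries are ignored). Zero forcing: given a simple graph, colour the vertices of a subset $Z$ blue. The colour propagates by the rules: (1) a blue vertex remains blue; (2) if a blue vertex $i$ has exactly one non-blue neighbour $j$, then $j$ becomes blue. $Z$ is a zero forcing set if eventually all vertices become blue. The dynamics of the observed states $Z$ is the collection of all values $(P^n)_{ij}$ with $i,j\in Z$ and $n\in\mathbb{N}$.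 The structure of the model (its graph) is regarded as known, and the matrix entries are the unknown parameters. -}

module Defs where

open import Level using (Level; _⊔_; Lift) renaming (suc to lsuc)
open import Algebra.Apartness.Bundles using (HeytingField; HeytingCommutativeRing)
open import Algebra.Bundles using (CommutativeRing)
import Algebra.Definitions.RawMonoid as RawMonoidDefs
open import Data.Bool.Base using (if_then_else_)
open import Data.Fin.Base as Fin using (Fin)
open import Data.Fin.Properties as Fin using (_≟_)
open import Data.Fin.Subset using (Subset; _∈_)
open import Data.Nat.Base as ℕ using (ℕ; zero; suc)
open import Data.Product.Base using (_×_; _,_; ∃-syntax)
open import Data.Sum.Base using (_⊎_; inj₁; inj₂; swap)
open import Function.Bundles using (_⇔_)
open import Relation.Binary.Construct.Closure.ReflexiveTransitive using (Star)
open import Relation.Binary.Core using (Rel)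
open import Relation.Binary.Definitions using (Symmetric; Irreflexive)
open import Relation.Binary.PropositionalEquality.Core using (_≡_; refl)
open import Relation.Binary.Structures using (IsStrictPartialOrder)
open import Relation.Nullary.Decidable.Core using (⌊_⌋)
open import Relation.Nullary.Negation.Core using (¬_)

-- The standard library has no real numbers, so ℝ is given by its
-- characterisation as the Archimedean, Cauchy complete ordered field.
-- Classically this determines ℝ up to isomorphism.  The axioms are the
-- constructive ones (no trichotomy, nonzero elements invertible in the sense of
-- apartness), so Bishop's Cauchy reals are also a model.
record RealNumbers (c ℓ₁ ℓ₂ ℓ₃ : Level) : Set (lsuc (c ⊔ ℓ₁ ⊔ ℓ₂ ⊔ ℓ₃)) where
  infix 4 _<_ _≤_
  field
    heytingField : HeytingField c ℓ₁ ℓ₂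

  open HeytingField heytingField public

  field
    _<_                  : Rel Carrier ℓ₃
    isStrictPartialOrder : IsStrictPartialOrder _≈_ _<_
    #⇔<⊎>                : ∀ x y → x # y ⇔ (x < y ⊎ y < x)
    +-monoˡ-<            : ∀ {x y} z → x < y → (x + z) < (y + z)
    *-pos                : ∀ {x y} → 0# < x → 0# < y → 0# < (x * y)

  open CommutativeRing (HeytingCommutativeRing.commutativeRing heytingCommutativeRing) public
    using (semiring; +-rawMonoid)
  open RawMonoidDefs +-rawMonoid public using (sum) renaming (_×_ to _·_)

  _≤_ : Rel Carrier ℓ₃
  x ≤ y = ¬ (y < x)

  -- ∣ x - y ∣ < ε
  Within : Carrier → Carrier → Carrier → Set ℓ₃
  Within ε x y = x < y + ε × y < x + ε

  IsCauchy : (ℕ → Carrier) → Set (c ⊔ ℓ₃)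
  IsCauchy s = ∀ ε → 0# < ε → ∃[ N ] (∀ m n → N ℕ.≤ m → N ℕ.≤ n → Within ε (s m) (s n))

  _ConvergesTo_ : (ℕ → Carrier) → Carrier → Set (c ⊔ ℓ₃)
  s ConvergesTo l = ∀ ε → 0# < ε → ∃[ N ] (∀ n → N ℕ.≤ n → Within ε (s n) l)

  field
    archimedean : ∀ x → ∃[ n ] x < n · 1#
    complete    : ∀ s → IsCauchy s → ∃[ l ] s ConvergesTo l


record SimpleGraph (S : ℕ) (ℓ : Level) : Set (lsuc ℓ) where
  field
    Adj    : Rel (Fin S) ℓ
    sym    : Symmetric Adj
    irrefl : Irreflexive _≡_ Adj

module _ {S : ℕ} {ℓ : Level} where

  open SimpleGraph

  infix 4 _≅_

  -- Equality of graphs on the same labelled vertex set (not isomorphism).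
  _≅_ : SimpleGraph S ℓ → SimpleGraph S ℓ → Set ℓ
  G ≅ H = ∀ i j → Adj G i j ⇔ Adj H i j

  Connected : SimpleGraph S ℓ → Set ℓ
  Connected G = ∀ i j → Star (Adj G) i j

  module _ (G : SimpleGraph S ℓ) (Z : Subset S) where

    mutual
      -- The vertices that are blue after t rounds; in each round the colour
      -- change rule is applied to all blue vertices simultaneously.
      Blue : ℕ → Fin S → Set ℓ
      Blue zero    j = Lift ℓ (j ∈ Z)
      Blue (suc t) j = Blue t j ⊎ (∃[ i ] Forces t i j)

      -- i is blue and j is its only non-blue neighbour.
      Forces : ℕ → Fin S → Fin S → Set ℓ
      Forces t i j =
        Blue t i × Adj G i j × ¬ Blue t j ×
        (∀ k → Adj G i k → ¬ Blue t k → k ≡ j)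

    ZeroForcing : Set ℓ
    ZeroForcing = ∃[ t ] (∀ j → Blue t j)


module Matrices {c ℓ₁ ℓ₂ ℓ₃ : Level} (ℝ : RealNumbers c ℓ₁ ℓ₂ ℓ₃) where

  open RealNumbers ℝ using (Carrier; _≈_; _*_; 0#; 1#; sum; _≤_)

  Matrix : ℕ → Set c
  Matrix S = Fin S → Fin S → Carrier

  module _ {S : ℕ} where

    infix  4 _≋_
    infixl 7 _⊗_
    infixr 8 _^_

    _≋_ : Matrix S → Matrix S → Set ℓ₁
    M ≋ N = ∀ i j → M i j ≈ N i j

    I : Matrix S
    I i j = if ⌊ i ≟ j ⌋ then 1# else 0#

    _⊗_ : Matrix S → Matrix S → Matrix S
    (M ⊗ N) i j = sum (λ k → M i k * N k j)

    _^_ : Matrix S → ℕ → Matrix S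
    M ^ zero  = I
    M ^ suc n = M ⊗ M ^ n

    record RowStochastic (P : Matrix S) : Set (ℓ₁ ⊔ ℓ₃) where
      field
        nonNegative : ∀ i j → 0# ≤ P i j
        rowSum      : ∀ i → sum (P i) ≈ 1#

    CombinatoriallySymmetric : Matrix S → Set ℓ₁
    CombinatoriallySymmetric M = ∀ i j → ¬ (M i j ≈ 0#) → ¬ (M j i ≈ 0#)

    -- An edge {i , j} is read off from the entry above the diagonal.
    𝒢 : Matrix S → SimpleGraph S ℓ₁
    𝒢 M = record
      { Adj    = λ i j → (i Fin.< j × ¬ (M i j ≈ 0#)) ⊎ (j Fin.< i × ¬ (M j i ≈ 0#))
      ; sym    = swap
      ; irrefl = λ { refl (inj₁ (i<i , _)) → Fin.<-irrefl refl i<i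
                   ; refl (inj₂ (i<i , _)) → Fin.<-irrefl refl i<i }
      }

    SameDynamicsOn : Subset S → Matrix S → Matrix S → Set ℓ₁
    SameDynamicsOn Z P P′ =
      ∀ i j → i ∈ Z → j ∈ Z → ∀ n → (P′ ^ n) i j ≈ (P ^ n) i j

{-# OPTIONS --safe #-}

-- The values on the observed states determine P only up to a diagonal scaling:
-- along the zero forcing process one builds nonzero weights d with
-- d i * (P′ ^ n) i j = (P ^ n) i j * d j for all blue i, j and all n.  When i is
-- blue and j is its only non-blue neighbour, expanding P ^ (n + 1) along row i
-- leaves a single unknown term, through j, and this dictates
-- d j = d i * P′ i j / P i j; expanding along column i then does the same for the
-- columns.  Once all vertices are blue, n = 1 and the row sums of P′ give
-- P d = d, and by the maximum principle on a connected graph d is constant, so it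
-- cancels.
--
-- Case distinctions and choices over Fin S are made under double negation, which
-- is harmless since equality of reals is stable.
module Submission where

open import Defs
open import Data.Nat.Base using (ℕ)
open import Data.Fin.Subset using (Subset)

import Algebra.Apartness.Properties.HeytingCommutativeRing as HeytingProperties
import Algebra.Properties.Ring as RingProperties
import Algebra.Properties.Semiring.Sum as SumProperties
import Relation.Binary.Reasoning.Setoid as SetoidReasoning
open import Algebra.Bundles using (CommutativeRing)
open import Data.Empty using (⊥-elim)
open import Data.Fin.Base using (Fin; punchIn) renaming (zero to fzero; suc to fsuc)
open import Data.Fin.Properties using (_≟_; <-cmp; punchInᵢ≢i)
open import Data.Nat.Base using (zero; suc)
open import Data.Product.Base using (_×_; _,_; proj₁; proj₂; ∃-syntax)
open import Data.Sum.Base using (_⊎_; inj₁; inj₂; [_,_]′)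
open import Data.Vec.Functional using (removeAt)
open import Function.Base using (_∘_)
open import Function.Bundles using (Equivalence)
open import Level using (Level; lift)
open import Relation.Binary.Construct.Closure.ReflexiveTransitive using (Star; ε; _◅_)
open import Relation.Binary.Definitions using (tri<; tri≈; tri>)
open import Relation.Binary.PropositionalEquality.Core using (_≡_; _≢_)
  renaming (refl to ≡-refl; sym to ≡-sym)
open import Relation.Binary.Structures using (IsStrictPartialOrder)
open import Relation.Nullary.Decidable.Core using (yes; no; ¬¬-excluded-middle)
open import Relation.Nullary.Negation.Core using (¬_; Stable; contradiction)
open import Relation.Unary using (Pred; _⊆_)

-- The double-negation monad that drives the `do` blocks.

module _ {a b : Level} {A : Set a} {B : Set b} where

  _>>=_ : ¬ ¬ A → (A → ¬ ¬ B) → ¬ ¬ B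
  (¬¬a >>= f) ¬b = ¬¬a (λ a → f a ¬b)

return : ∀ {a} {A : Set a} → A → ¬ ¬ A
return a ¬a = ¬a a

-- Double negation passes through finite conjunctions. This acts as finite choice: witnesses found
-- separately at each index are collected into one function.
¬¬-∀-Fin : ∀ {p n} {P : Fin n → Set p} → (∀ i → ¬ ¬ P i) → ¬ ¬ (∀ i → P i)
¬¬-∀-Fin {n = zero}  ¬¬p = return λ ()
¬¬-∀-Fin {n = suc n} ¬¬p = do
  p₀ ← ¬¬p fzero
  p₊ ← ¬¬-∀-Fin (¬¬p ∘ fsuc)
  return λ { fzero → p₀ ; (fsuc i) → p₊ i }

module _ {c ℓ₁ ℓ₂ ℓ₃ : Level} (ℝ : RealNumbers c ℓ₁ ℓ₂ ℓ₃) where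

  open RealNumbers ℝ hiding (zero)
  open Matrices ℝ
  open HeytingProperties heytingCommutativeRing using (1#0; x-0≈x)
  private
    module <ᵒ = IsStrictPartialOrder isStrictPartialOrder
    commutativeRing : CommutativeRing c ℓ₁
    commutativeRing = record { isCommutativeRing = isCommutativeRing }
    open CommutativeRing commutativeRing using (ring)
  open RingProperties ring using (+-cancelʳ)
  open SumProperties semiring
    using (sum-cong-≋; sum-remove; sum-replicate-zero; ∑-comm; ∑-distrib-+; *-distribˡ-sum; *-distribʳ-sum)
  open SetoidReasoning setoid

  infix 4 _≉_
  _≉_ : Carrier → Carrier → Set ℓ₁
  x ≉ y = ¬ (x ≈ y)

  -- Tightness makes equality the negation of apartness. This is the exit from the double-negation
  -- monad whenever the goal is an equation.
  ≈-stable : ∀ {x y} → Stable (x ≈ y)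
  ≈-stable {x} {y} ¬¬x≈y = proj₁ (tight x y) λ x#y → ¬¬x≈y λ x≈y → #-irrefl x≈y x#y

  -- Field arithmetic

  -- Inversion requires apartness from zero, which tightness yields from `a ≉ 0#` only under double
  -- negation.
  divide : ∀ {a} b → a ≉ 0# → ¬ ¬ (∃[ q ] a * q ≈ b)
  divide {a} b a≉0 = do
    a#0 ← λ ¬a#0 → a≉0 (proj₁ (tight a 0#) ¬a#0)
    let a⁻¹ , _ , aa⁻¹≈1 = #⇒invertible a#0
    return (a⁻¹ * b , (begin
      a * (a⁻¹ * b)         ≈⟨ *-assoc a a⁻¹ b ⟨
      -- Apartness `a # 0#` inverts the difference `a - 0#`, so the zero has to be inserted first.
      a * a⁻¹ * b           ≈⟨ *-congʳ (*-congʳ (x-0≈x a)) ⟨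
      (a - 0#) * a⁻¹ * b    ≈⟨ *-congʳ aa⁻¹≈1 ⟩
      1# * b                ≈⟨ *-identityˡ b ⟩
      b                     ∎))

  *-cancelʳ-≉0 : ∀ {a x y} → a ≉ 0# → x * a ≈ y * a → x ≈ y
  *-cancelʳ-≉0 {a} {x} {y} a≉0 xa≈ya = ≈-stable do
    b , ab≈1 ← divide 1# a≉0
    let cancel : ∀ z → z * a * b ≈ z
        cancel z = trans (*-assoc z a b) (trans (*-congˡ ab≈1) (*-identityʳ z))
    return (begin
      x          ≈⟨ cancel x ⟨
      x * a * b  ≈⟨ *-congʳ xa≈ya ⟩
      y * a * b  ≈⟨ cancel y ⟩
      y          ∎)

  *-≉0 : ∀ {x y} → x ≉ 0# → y ≉ 0# → x * y ≉ 0#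
  *-≉0 {x} {y} x≉0 y≉0 xy≈0 = x≉0 (*-cancelʳ-≉0 y≉0 (trans xy≈0 (sym (zeroˡ y))))

  -- Order

  -- If `x < y` fails as well as `y < x`, then `x` and `y` cannot be apart, and tightness makes them
  -- equal.
  ≤⇒¬¬<⊎≈ : ∀ {x y} → x ≤ y → ¬ ¬ (x < y ⊎ x ≈ y)
  ≤⇒¬¬<⊎≈ {x} {y} x≤y h = h (inj₂ (proj₁ (tight x y) λ x#y →
    [ h ∘ inj₁ , x≤y ]′ (Equivalence.to (#⇔<⊎> x y) x#y)))

  ≤-¬¬total : ∀ x y → ¬ ¬ (x ≤ y ⊎ y ≤ x)
  ≤-¬¬total x y h = h (inj₁ λ y<x → h (inj₂ λ x<y → <ᵒ.asym x<y y<x))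

  ≤-trans : ∀ {x y z} → x ≤ y → y ≤ z → x ≤ z
  ≤-trans x≤y y≤z z<x = ≤⇒¬¬<⊎≈ x≤y λ where
    (inj₁ x<y) → y≤z (<ᵒ.trans z<x x<y)
    (inj₂ x≈y) → y≤z (proj₁ <ᵒ.<-resp-≈ x≈y z<x)

  ≤-refl : ∀ {x} → x ≤ x
  ≤-refl = <ᵒ.irrefl refl

  <-resp : ∀ {x x′ y y′} → x ≈ x′ → y ≈ y′ → x < y → x′ < y′
  <-resp x≈x′ y≈y′ = proj₁ <ᵒ.<-resp-≈ y≈y′ ∘ proj₂ <ᵒ.<-resp-≈ x≈x′

  0≤y-x : ∀ {x y} → x ≤ y → 0# ≤ y - x
  0≤y-x {x} {y} x≤y y-x<0 = x≤y (<-resp y-x+x≈y (+-identityˡ x) (+-monoˡ-< x y-x<0))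
    where
    y-x+x≈y : y - x + x ≈ y
    y-x+x≈y = trans (+-assoc y (- x) x) (trans (+-congˡ (-‿inverseˡ x)) (+-identityʳ y))

  0<x⇒y<x+y : ∀ {x} y → 0# < x → y < x + y
  0<x⇒y<x+y y 0<x = <-resp (+-identityˡ y) refl (+-monoˡ-< y 0<x)

  *-nonNegative : ∀ {x y} → 0# ≤ x → 0# ≤ y → 0# ≤ x * y
  *-nonNegative {x} {y} 0≤x 0≤y xy<0 = ≤⇒¬¬<⊎≈ 0≤x λ where
    (inj₂ 0≈x) → <ᵒ.irrefl (trans (*-congʳ (sym 0≈x)) (zeroˡ y)) xy<0
    (inj₁ 0<x) → ≤⇒¬¬<⊎≈ 0≤y λ where
      (inj₂ 0≈y) → <ᵒ.irrefl (trans (*-congˡ (sym 0≈y)) (zeroʳ x)) xy<0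
      (inj₁ 0<y) → <ᵒ.asym (*-pos 0<x 0<y) xy<0

  +-nonNegative : ∀ {x y} → 0# ≤ x → 0# ≤ y → 0# ≤ x + y
  +-nonNegative {x} {y} 0≤x 0≤y x+y<0 = ≤⇒¬¬<⊎≈ 0≤x λ where
    (inj₁ 0<x) → 0≤y (<ᵒ.trans (0<x⇒y<x+y y 0<x) x+y<0)
    (inj₂ 0≈x) → 0≤y (<-resp (trans (+-congʳ (sym 0≈x)) (+-identityˡ y)) refl x+y<0)

  x+y≈0⇒x≈0 : ∀ {x y} → 0# ≤ x → 0# ≤ y → x + y ≈ 0# → x ≈ 0#
  x+y≈0⇒x≈0 {x} {y} 0≤x 0≤y x+y≈0 = ≈-stable do
    inj₁ 0<x ← ≤⇒¬¬<⊎≈ 0≤x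
      where inj₂ 0≈x → return (sym 0≈x)
    -- A positive `x` would give `y < x + y ≈ 0#`.
    ⊥-elim (0≤y (<-resp refl x+y≈0 (0<x⇒y<x+y y 0<x)))

  sum-nonNegative : ∀ {n} (f : Fin n → Carrier) → (∀ i → 0# ≤ f i) → 0# ≤ sum f
  sum-nonNegative {zero}  f 0≤f = ≤-refl
  sum-nonNegative {suc n} f 0≤f = +-nonNegative (0≤f fzero) (sum-nonNegative (f ∘ fsuc) (0≤f ∘ fsuc))

  sum≈0⇒≈0 : ∀ {n} (f : Fin n → Carrier) → (∀ i → 0# ≤ f i) → sum f ≈ 0# → ∀ i → f i ≈ 0#
  sum≈0⇒≈0 {suc n} f 0≤f ∑f≈0 i =
    x+y≈0⇒x≈0 (0≤f i) (sum-nonNegative (removeAt f i) (0≤f ∘ punchIn i))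
      (trans (sym (sum-remove f)) ∑f≈0)

  ¬¬-argmax : ∀ {n} (f : Fin (suc n) → Carrier) → ¬ ¬ (∃[ i ] (∀ j → f j ≤ f i))
  ¬¬-argmax {zero}  f = return (fzero , λ { fzero → ≤-refl })
  ¬¬-argmax {suc n} f = do
    i , f₊≤fᵢ ← ¬¬-argmax (f ∘ fsuc)
    inj₁ f₀≤fᵢ ← ≤-¬¬total (f fzero) (f (fsuc i))
      where inj₂ fᵢ≤f₀ → return (fzero , λ { fzero → ≤-refl ; (fsuc j) → ≤-trans (f₊≤fᵢ j) fᵢ≤f₀ })
    return (fsuc i , λ { fzero → f₀≤fᵢ ; (fsuc j) → f₊≤fᵢ j })

  -- Sums and matrix powers

  -- The common remainder cancels. This is the algebraic counterpart of the colour change rule: one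
  -- unknown term is determined by all the others.
  sum-isolate : ∀ {n} (f g : Fin n → Carrier) j → (∀ k → k ≢ j → f k ≈ g k) → sum f ≈ sum g → f j ≈ g j
  sum-isolate {suc n} f g j f≈g ∑f≈∑g = +-cancelʳ (sum (removeAt g j)) (f j) (g j) (begin
    f j + sum (removeAt g j)  ≈⟨ +-congˡ (sum-cong-≋ (λ k → f≈g (punchIn j k) (punchInᵢ≢i j k))) ⟨
    f j + sum (removeAt f j)  ≈⟨ sum-remove f ⟨
    sum f                     ≈⟨ ∑f≈∑g ⟩
    sum g                     ≈⟨ sum-remove g ⟩
    g j + sum (removeAt g j)  ∎)

  sum-single : ∀ {n} (f : Fin n → Carrier) j → (∀ k → k ≢ j → f k ≈ 0#) → sum f ≈ f j
  sum-single {suc n} f j f≈0 = begin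
    sum f                     ≈⟨ sum-remove f ⟩
    f j + sum (removeAt f j)  ≈⟨ +-congˡ (sum-cong-≋ (λ k → f≈0 (punchIn j k) (punchInᵢ≢i j k))) ⟩
    f j + sum {n} (λ _ → 0#)  ≈⟨ +-congˡ (sum-replicate-zero n) ⟩
    f j + 0#                  ≈⟨ +-identityʳ (f j) ⟩
    f j                       ∎

  module _ {S : ℕ} where

    I-diagonal : (i : Fin S) → I i i ≈ 1#
    I-diagonal i with i ≟ i
    ... | yes _  = refl
    ... | no i≢i = contradiction ≡-refl i≢i

    I-offDiagonal : {i j : Fin S} → i ≢ j → I i j ≈ 0#
    I-offDiagonal {i} {j} i≢j with i ≟ j
    ... | yes i≡j = contradiction i≡j i≢j
    ... | no _    = refl

    ⊗-identityʳ : (M : Matrix S) → M ⊗ I ≋ M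
    ⊗-identityʳ M i j = begin
      (M ⊗ I) i j    ≈⟨ sum-single _ j (λ k k≢j → trans (*-congˡ (I-offDiagonal k≢j)) (zeroʳ _)) ⟩
      M i j * I j j  ≈⟨ *-congˡ (I-diagonal j) ⟩
      M i j * 1#     ≈⟨ *-identityʳ (M i j) ⟩
      M i j          ∎

    ⊗-identityˡ : (M : Matrix S) → I ⊗ M ≋ M
    ⊗-identityˡ M i j = begin
      (I ⊗ M) i j    ≈⟨ sum-single _ i (λ k k≢i → trans (*-congʳ (I-offDiagonal (k≢i ∘ ≡-sym))) (zeroˡ _)) ⟩
      I i i * M i j  ≈⟨ *-congʳ (I-diagonal i) ⟩
      1# * M i j     ≈⟨ *-identityˡ (M i j) ⟩
      M i j          ∎

    ⊗-assoc : (L M N : Matrix S) → (L ⊗ M) ⊗ N ≋ L ⊗ (M ⊗ N)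
    ⊗-assoc L M N i j = begin
      sum (λ l → sum (λ k → L i k * M k l) * N l j)    ≈⟨ sum-cong-≋ (λ l → *-distribʳ-sum (N l j) (λ k → L i k * M k l)) ⟩
      sum (λ l → sum (λ k → L i k * M k l * N l j))    ≈⟨ ∑-comm (λ l k → L i k * M k l * N l j) ⟩
      sum (λ k → sum (λ l → L i k * M k l * N l j))    ≈⟨ sum-cong-≋ (λ k → sum-cong-≋ (λ l → *-assoc (L i k) (M k l) (N l j))) ⟩
      sum (λ k → sum (λ l → L i k * (M k l * N l j)))  ≈⟨ sum-cong-≋ (λ k → *-distribˡ-sum (L i k) (λ l → M k l * N l j)) ⟨
      sum (λ k → L i k * sum (λ l → M k l * N l j))    ∎

    -- Powers unfold on the left, which suits expansion along rows; expansion along columns needs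
    -- the last factor split off instead.
    ^-sucʳ : (M : Matrix S) (n : ℕ) → M ^ suc n ≋ M ^ n ⊗ M
    ^-sucʳ M zero    i j = trans (⊗-identityʳ M i j) (sym (⊗-identityˡ M i j))
    ^-sucʳ M (suc n) i j = begin
      (M ⊗ M ^ suc n) i j    ≈⟨ sum-cong-≋ (λ k → *-congˡ (^-sucʳ M n k j)) ⟩
      (M ⊗ (M ^ n ⊗ M)) i j  ≈⟨ ⊗-assoc M (M ^ n) M i j ⟨
      (M ^ suc n ⊗ M) i j    ∎

  -- Propagation of the scaling

  module Scaling {S : ℕ} {g : Level} (Adj : Fin S → Fin S → Set g) (P P′ : Matrix S)
    (adj⇒≉0 : ∀ {i j} → Adj i j → P i j ≉ 0# × P′ i j ≉ 0#)
    (adj-sym : ∀ {i j} → Adj i j → Adj j i)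
    (¬adj⇒≈0 : ∀ {i j} → i ≢ j → ¬ Adj i j → P i j ≈ 0# × P′ i j ≈ 0#) where

    -- With `d` and `e` as diagonal matrices, this is the relation `d P′ⁿ = Pⁿ e` on the block of
    -- rows `A` and columns `B`. Two weights and two sets are kept because rows are extended before
    -- columns.
    Intertwines : ∀ {a b} → (d e : Fin S → Carrier) → Pred (Fin S) a → Pred (Fin S) b → Set _
    Intertwines d e A B = ∀ n {i j} → A i → B j → d i * (P′ ^ n) i j ≈ (P ^ n) i j * e j

    module _ {d e : Fin S → Carrier} {a b} {A : Pred (Fin S) a} {B : Pred (Fin S) b}
      (de : Intertwines d e A B) where

      intertwines-1 : ∀ {i j} → A i → B j → d i * P′ i j ≈ P i j * e j
      intertwines-1 {i} {j} i∈A j∈B = begin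
        d i * P′ i j        ≈⟨ *-congˡ (⊗-identityʳ P′ i j) ⟨
        d i * (P′ ^ 1) i j  ≈⟨ de 1 i∈A j∈B ⟩
        (P ^ 1) i j * e j   ≈⟨ *-congʳ (⊗-identityʳ P i j) ⟩
        P i j * e j         ∎

      -- The zeroth power is the identity, so the diagonal entry compares the two weights directly.
      intertwines-0 : ∀ {i} → A i → B i → d i ≈ e i
      intertwines-0 {i} i∈A i∈B = begin
        d i          ≈⟨ *-identityʳ (d i) ⟨
        d i * 1#     ≈⟨ *-congˡ (I-diagonal i) ⟨
        d i * I i i  ≈⟨ de 0 i∈A i∈B ⟩
        I i i * e i  ≈⟨ *-congʳ (I-diagonal i) ⟩
        1# * e i     ≈⟨ *-identityˡ (e i) ⟩
        e i          ∎

    record Forced {b} (B : Pred (Fin S) b) (i j : Fin S) : Set (g Level.⊔ b) where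
      field
        blue   : B i
        adj    : Adj i j
        unique : ∀ k → Adj i k → ¬ B k → k ≡ j

      -- Every term other than the one through `j` is either covered by the blue block or zero. The
      -- diagonal term `k = i` falls in the first case because `i` is blue, so the second concerns
      -- off-diagonal entries only.
      neighbours : ∀ {k} → k ≢ j → ¬ ¬ (B k ⊎ (i ≢ k × ¬ Adj i k))
      neighbours k≢j h = h (inj₂
        ( (λ { ≡-refl → h (inj₁ blue) })
        , (λ i~k → k≢j (unique _ i~k (h ∘ inj₁)))))

    open Forced

    module _ {b} {B : Pred (Fin S) b} {i j : Fin S} (i→j : Forced B i j) where

      -- Both sides are the terms through `j` in the expansions of the power `suc n` along row `i`;
      -- the full sums agree because `i` and `l` are blue.
      force-row : ∀ {d} → Intertwines d d B B → ∀ n {l} → B l →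
                  d i * (P′ i j * (P′ ^ n) j l) ≈ P i j * (P ^ n) j l * d l
      force-row {d} dd n {l} l∈B = sum-isolate f h j f≈h (begin
        sum f                    ≈⟨ *-distribˡ-sum (d i) (λ k → P′ i k * (P′ ^ n) k l) ⟨
        d i * (P′ ^ suc n) i l   ≈⟨ dd (suc n) (blue i→j) l∈B ⟩
        (P ^ suc n) i l * d l    ≈⟨ *-distribʳ-sum (d l) (λ k → P i k * (P ^ n) k l) ⟩
        sum h                    ∎)
        where
        f h : Fin S → Carrier
        f k = d i * (P′ i k * (P′ ^ n) k l)
        h k = P i k * (P ^ n) k l * d l

        f≈h : ∀ k → k ≢ j → f k ≈ h k
        f≈h k k≢j = ≈-stable do
          inj₁ k∈B ← neighbours i→j k≢j
            where inj₂ (i≢k , i≁k) → let P≈0 , P′≈0 = ¬adj⇒≈0 i≢k i≁k in return (begin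
                    d i * (P′ i k * (P′ ^ n) k l)  ≈⟨ *-congˡ (trans (*-congʳ P′≈0) (zeroˡ _)) ⟩
                    d i * 0#                       ≈⟨ zeroʳ _ ⟩
                    0#                             ≈⟨ zeroˡ _ ⟨
                    0# * d l                       ≈⟨ *-congʳ (trans (*-congʳ P≈0) (zeroˡ _)) ⟨
                    P i k * (P ^ n) k l * d l      ∎)
          return (begin
            d i * (P′ i k * (P′ ^ n) k l)  ≈⟨ *-assoc _ _ _ ⟨
            d i * P′ i k * (P′ ^ n) k l    ≈⟨ *-congʳ (intertwines-1 dd (blue i→j) k∈B) ⟩
            -- The weight has moved from `i` to `k` by the one-step relation; the relation for the
            -- power `n` next carries it from `k` to `l`.
            P i k * d k * (P′ ^ n) k l     ≈⟨ *-assoc _ _ _ ⟩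
            P i k * (d k * (P′ ^ n) k l)   ≈⟨ *-congˡ (dd n k∈B l∈B) ⟩
            P i k * ((P ^ n) k l * d l)    ≈⟨ *-assoc _ _ _ ⟨
            P i k * (P ^ n) k l * d l      ∎)

      -- The transposed argument, in column `i`. The row index ranges over a larger set `A` since
      -- the rows of the newly blue vertices have been treated by then.
      force-column : ∀ {d a} {A : Pred (Fin S) a} → B ⊆ A → Intertwines d d A B → ∀ n {l} → A l →
                     d l * ((P′ ^ n) l j * P′ j i) ≈ (P ^ n) l j * P j i * d i
      force-column {d} B⊆A dd n {l} l∈A = sum-isolate f h j f≈h (begin
        sum f                    ≈⟨ *-distribˡ-sum (d l) (λ k → (P′ ^ n) l k * P′ k i) ⟨
        d l * (P′ ^ n ⊗ P′) l i  ≈⟨ *-congˡ (^-sucʳ P′ n l i) ⟨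
        d l * (P′ ^ suc n) l i   ≈⟨ dd (suc n) l∈A (blue i→j) ⟩
        (P ^ suc n) l i * d i    ≈⟨ *-congʳ (^-sucʳ P n l i) ⟩
        (P ^ n ⊗ P) l i * d i    ≈⟨ *-distribʳ-sum (d i) (λ k → (P ^ n) l k * P k i) ⟩
        sum h                    ∎)
        where
        f h : Fin S → Carrier
        f k = d l * ((P′ ^ n) l k * P′ k i)
        h k = (P ^ n) l k * P k i * d i

        f≈h : ∀ k → k ≢ j → f k ≈ h k
        f≈h k k≢j = ≈-stable do
          inj₁ k∈B ← neighbours i→j k≢j
            where inj₂ (i≢k , i≁k) → let P≈0 , P′≈0 = ¬adj⇒≈0 (i≢k ∘ ≡-sym) (i≁k ∘ adj-sym) in return (begin
                    d l * ((P′ ^ n) l k * P′ k i)  ≈⟨ *-congˡ (trans (*-congˡ P′≈0) (zeroʳ _)) ⟩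
                    d l * 0#                       ≈⟨ zeroʳ _ ⟩
                    0#                             ≈⟨ zeroˡ _ ⟨
                    0# * d i                       ≈⟨ *-congʳ (trans (*-congˡ P≈0) (zeroʳ _)) ⟨
                    (P ^ n) l k * P k i * d i      ∎)
          return (begin
            d l * ((P′ ^ n) l k * P′ k i)  ≈⟨ *-assoc _ _ _ ⟨
            d l * (P′ ^ n) l k * P′ k i    ≈⟨ *-congʳ (dd n l∈A k∈B) ⟩
            (P ^ n) l k * d k * P′ k i     ≈⟨ *-assoc _ _ _ ⟩
            (P ^ n) l k * (d k * P′ k i)   ≈⟨ *-congˡ (intertwines-1 dd (B⊆A k∈B) (blue i→j)) ⟩
            (P ^ n) l k * (P k i * d i)    ≈⟨ *-assoc _ _ _ ⟨
            (P ^ n) l k * P k i * d i      ∎)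

    Scalable : ∀ {b} → Pred (Fin S) b → Set _
    Scalable B = ∃[ d ] (∀ i → d i ≉ 0#) × Intertwines d d B B

    module _ {b b′} {B : Pred (Fin S) b} {B′ : Pred (Fin S) b′}
      (B⊆B′ : B ⊆ B′) (forced : ∀ {j} → B′ j → B j ⊎ (∃[ i ] Forced B i j)) where

      -- The weight is chosen one vertex at a time and before `B′ j` is assumed, so that the choices
      -- can be collected over all of `Fin S`.
      extend-rows : ∀ {d} → (∀ i → d i ≉ 0#) → Intertwines d d B B →
                    ∀ j → ¬ ¬ (∃[ c ] c ≉ 0# × (B′ j → ∀ n {l} → B l → c * (P′ ^ n) j l ≈ (P ^ n) j l * d l))
      extend-rows {d} d≉0 dd j = do
        yes j∈B′ ← ¬¬-excluded-middle {A = B′ j}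
          -- Outside `B′` the weight is unconstrained apart from being nonzero; the old value serves
          -- as default.
          where no j∉B′ → return (d j , d≉0 j , λ j∈B′ → contradiction j∈B′ j∉B′)
        inj₂ (i , i→j) ← return (forced j∈B′)
          where inj₁ j∈B → return (d j , d≉0 j , λ _ n {_} l∈B → dd n j∈B l∈B)
        let P≉0 , P′≉0 = adj⇒≉0 (adj i→j)
        -- The quotient solves the one-step relation from `i` to `j` for the new weight; it is
        -- nonzero because `d i` and `P′ i j` are.
        q , Pq≈dP′ ← divide (d i * P′ i j) P≉0
        return
          ( q
          , (λ q≈0 → *-≉0 (d≉0 i) P′≉0 (trans (sym Pq≈dP′) (trans (*-congˡ q≈0) (zeroʳ _))))
          , λ _ n {l} l∈B → *-cancelʳ-≉0 P≉0 (begin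
              q * (P′ ^ n) j l * P i j        ≈⟨ *-comm _ _ ⟩
              P i j * (q * (P′ ^ n) j l)      ≈⟨ *-assoc _ _ _ ⟨
              P i j * q * (P′ ^ n) j l        ≈⟨ *-congʳ Pq≈dP′ ⟩
              d i * P′ i j * (P′ ^ n) j l     ≈⟨ *-assoc _ _ _ ⟩
              d i * (P′ i j * (P′ ^ n) j l)   ≈⟨ force-row i→j dd n l∈B ⟩
              P i j * (P ^ n) j l * d l       ≈⟨ *-assoc _ _ _ ⟩
              P i j * ((P ^ n) j l * d l)     ≈⟨ *-comm _ _ ⟩
              (P ^ n) j l * d l * P i j       ∎))

      -- No weight remains to be chosen: the row of `j` is already known, so the one-step relation
      -- from `j` back to `i` replaces `P j i * d i` by `d j * P′ j i`, and the nonzero factor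
      -- `P′ j i` cancels.
      extend-columns : ∀ {d} → Intertwines d d B′ B → Intertwines d d B′ B′
      extend-columns {d} dd n {l} {j} l∈B′ j∈B′ with forced j∈B′
      ... | inj₁ j∈B       = dd n l∈B′ j∈B
      ... | inj₂ (i , i→j) = *-cancelʳ-≉0 (proj₂ (adj⇒≉0 (adj-sym (adj i→j)))) (begin
        d l * (P′ ^ n) l j * P′ j i    ≈⟨ *-assoc _ _ _ ⟩
        d l * ((P′ ^ n) l j * P′ j i)  ≈⟨ force-column i→j B⊆B′ dd n l∈B′ ⟩
        (P ^ n) l j * P j i * d i      ≈⟨ *-assoc _ _ _ ⟩
        (P ^ n) l j * (P j i * d i)    ≈⟨ *-congˡ (intertwines-1 dd j∈B′ (blue i→j)) ⟨
        (P ^ n) l j * (d j * P′ j i)   ≈⟨ *-assoc _ _ _ ⟨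
        (P ^ n) l j * d j * P′ j i     ∎)

      extend : Scalable B → ¬ ¬ Scalable B′
      extend (d , d≉0 , dd) = do
        rows ← ¬¬-∀-Fin (extend-rows d≉0 dd)
        let d′ = proj₁ ∘ rows
            d′d : Intertwines d′ d B′ B
            d′d n {i} i∈B′ j∈B = proj₂ (proj₂ (rows i)) i∈B′ n j∈B
        -- The columns still carry the old weights `d`; on `B` these agree with `d′` by the zeroth
        -- power.
        return (d′ , proj₁ ∘ proj₂ ∘ rows , extend-columns λ n i∈B′ j∈B →
          trans (d′d n i∈B′ j∈B) (*-congˡ (sym (intertwines-0 d′d (B⊆B′ j∈B) j∈B))))

  -- Edges of the graph of a matrix

  -- Edges are read above the diagonal; combinatorial symmetry carries this to the entries below.
  adj⇒≉0 : ∀ {S} (M : Matrix S) → CombinatoriallySymmetric M →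
           ∀ {i j} → SimpleGraph.Adj (𝒢 M) i j → M i j ≉ 0#
  adj⇒≉0 M M-sym (inj₁ (_ , Mij≉0)) = Mij≉0
  adj⇒≉0 M M-sym (inj₂ (_ , Mji≉0)) = M-sym _ _ Mji≉0

  ¬adj⇒≈0 : ∀ {S} (M : Matrix S) → CombinatoriallySymmetric M →
            ∀ {i j} → i ≢ j → ¬ SimpleGraph.Adj (𝒢 M) i j → M i j ≈ 0#
  ¬adj⇒≈0 M M-sym {i} {j} i≢j i≁j = ≈-stable λ Mij≉0 → i≁j (edge Mij≉0)
    where
    edge : M i j ≉ 0# → SimpleGraph.Adj (𝒢 M) i j
    edge Mij≉0 with <-cmp i j
    ... | tri< i<j _ _ = inj₁ (i<j , Mij≉0)
    ... | tri≈ _ i≡j _ = contradiction i≡j i≢j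
    ... | tri> _ _ j<i = inj₂ (j<i , M-sym i j Mij≉0)

  -- Maximum principle

  module Harmonic {S : ℕ} {P : Matrix S} (P-stoch : RowStochastic P)
    {d : Fin S → Carrier} (Pd≈d : ∀ i → sum (λ j → P i j * d j) ≈ d i) where

    open RowStochastic P-stoch

    -- The numbers `P i k * (m - d k)` are nonnegative and sum to `m - d i`, which is zero. Hence
    -- each vanishes, and where `P i j` is nonzero the other factor must be zero.
    max-propagates : ∀ {m i} → (∀ j → d j ≤ m) → d i ≈ m → ∀ {j} → P i j ≉ 0# → d j ≈ m
    max-propagates {m} {i} d≤m dᵢ≈m {j} Pij≉0 = ≈-stable λ dⱼ≉m →
      *-≉0 Pij≉0
        (λ m-dⱼ≈0 → dⱼ≉m (+-cancelʳ (- d j) (d j) m (trans (-‿inverseʳ (d j)) (sym m-dⱼ≈0))))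
        (sum≈0⇒≈0 gap (λ k → *-nonNegative (nonNegative i k) (0≤y-x (d≤m k))) ∑gap≈0 j)
      where
      gap : Fin S → Carrier
      gap k = P i k * (m - d k)

      gap+Pd≈Pm : ∀ k → gap k + P i k * d k ≈ P i k * m
      gap+Pd≈Pm k = begin
        P i k * (m - d k) + P i k * d k  ≈⟨ distribˡ (P i k) (m - d k) (d k) ⟨
        P i k * (m - d k + d k)          ≈⟨ *-congˡ (+-assoc m (- d k) (d k)) ⟩
        P i k * (m + (- d k + d k))      ≈⟨ *-congˡ (+-congˡ (-‿inverseˡ (d k))) ⟩
        P i k * (m + 0#)                 ≈⟨ *-congˡ (+-identityʳ m) ⟩
        P i k * m                        ∎

      ∑gap≈0 : sum gap ≈ 0#
      ∑gap≈0 = +-cancelʳ m (sum gap) 0# (begin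
        sum gap + m                          ≈⟨ +-congˡ (trans (Pd≈d i) dᵢ≈m) ⟨
        sum gap + sum (λ k → P i k * d k)    ≈⟨ ∑-distrib-+ gap (λ k → P i k * d k) ⟨
        sum (λ k → gap k + P i k * d k)      ≈⟨ sum-cong-≋ gap+Pd≈Pm ⟩
        sum (λ k → P i k * m)                ≈⟨ *-distribʳ-sum m (P i) ⟨
        sum (P i) * m                        ≈⟨ *-congʳ (rowSum i) ⟩
        1# * m                               ≈⟨ *-identityˡ m ⟩
        m                                    ≈⟨ +-identityˡ m ⟨
        0# + m                               ∎)

    max-propagates* : CombinatoriallySymmetric P → ∀ {m i j} → (∀ k → d k ≤ m) →
                      Star (SimpleGraph.Adj (𝒢 P)) i j → d i ≈ m → d j ≈ m
    max-propagates* P-sym d≤m ε         dᵢ≈m = dᵢ≈m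
    max-propagates* P-sym d≤m (e ◅ es)  dᵢ≈m =
      max-propagates* P-sym d≤m es (max-propagates d≤m dᵢ≈m (adj⇒≉0 P P-sym e))

  -- The maximal value spreads along paths from an index where it is attained, and connectedness
  -- reaches every vertex.
  harmonic-constant : ∀ {S} {P : Matrix S} → RowStochastic P → CombinatoriallySymmetric P → Connected (𝒢 P) →
                      ∀ {d : Fin S → Carrier} → (∀ i → sum (λ j → P i j * d j) ≈ d i) → ∀ i j → d i ≈ d j
  harmonic-constant {suc _} P-stoch P-sym conn {d} Pd≈d i j = ≈-stable do
    m , d≤dₘ ← ¬¬-argmax d
    let open Harmonic P-stoch Pd≈d
        d≈dₘ : ∀ k → d k ≈ d m
        d≈dₘ k = max-propagates* P-sym d≤dₘ (conn m k) refl
    return (trans (d≈dₘ i) (sym (d≈dₘ j)))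

  -- From observed dynamics to a scaling on the blue vertices.

  module _ {S : ℕ} {P P′ : Matrix S} {Z : Subset S}
    (P-sym : CombinatoriallySymmetric P) (P′-sym : CombinatoriallySymmetric P′)
    (same-graph : 𝒢 P′ ≅ 𝒢 P) (same-dynamics : SameDynamicsOn Z P P′) where

    open SimpleGraph (𝒢 P) using (Adj) renaming (sym to adj-sym)

    open Scaling Adj P P′
      (λ i~j → adj⇒≉0 P P-sym i~j , adj⇒≉0 P′ P′-sym (Equivalence.from (same-graph _ _) i~j))
      adj-sym
      (λ i≢j i≁j → ¬adj⇒≈0 P P-sym i≢j i≁j , ¬adj⇒≈0 P′ P′-sym i≢j (i≁j ∘ Equivalence.to (same-graph _ _)))
      public

    blue-scalable : ∀ t → ¬ ¬ Scalable (Blue (𝒢 P) Z t)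
    blue-scalable zero = return
      -- On the observed states the powers coincide, so constant weights suffice.
      ( (λ _ → 1#)
      , (λ _ 1≈0 → #-irrefl 1≈0 1#0)
      , λ { n (lift i∈Z) (lift j∈Z) →
            trans (*-identityˡ _) (trans (same-dynamics _ _ i∈Z j∈Z n) (sym (*-identityʳ _))) })
    blue-scalable (suc t) = blue-scalable t >>= extend inj₁ λ where
      (inj₁ j∈B) → inj₁ j∈B
      (inj₂ (i , i∈B , i~j , _ , unique)) → inj₂ (i , record { blue = i∈B ; adj = i~j ; unique = unique })

theorem1 : ∀ {c ℓ₁ ℓ₂ ℓ₃} (ℝ : RealNumbers c ℓ₁ ℓ₂ ℓ₃) →
    let open Matrices ℝ in
    (S : ℕ) (P : Matrix S) (Z : Subset S) →
    CombinatoriallySymmetric P →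
    RowStochastic P →
    Connected (𝒢 P) →
    ZeroForcing (𝒢 P) Z →
    (P′ : Matrix S) →
    CombinatoriallySymmetric P′ →
    RowStochastic P′ →
    𝒢 P′ ≅ 𝒢 P →
    SameDynamicsOn Z P P′ →
    P′ ≋ P
theorem1 ℝ S P Z P-sym P-stoch conn (t , all-blue) P′ P′-sym P′-stoch same-graph same-dynamics i j =
  ≈-stable ℝ do
    d , d≉0 , dd ← blue-scalable ℝ P-sym P′-sym same-graph same-dynamics t
    let dP′≈Pd : ∀ i j → d i * P′ i j ≈ P i j * d j
        dP′≈Pd i j = intertwines-1 ℝ P-sym P′-sym same-graph same-dynamics dd (all-blue i) (all-blue j)
        -- Stochasticity of `P′` makes `d` harmonic for `P`, the form that the maximum principle
        -- requires.
        Pd≈d : ∀ i → sum (λ j → P i j * d j) ≈ d i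
        Pd≈d i = begin
          sum (λ j → P i j * d j)   ≈⟨ sum-cong-≋ (dP′≈Pd i) ⟨
          sum (λ j → d i * P′ i j)  ≈⟨ *-distribˡ-sum (d i) (P′ i) ⟨
          d i * sum (P′ i)          ≈⟨ *-congˡ (Matrices.RowStochastic.rowSum P′-stoch i) ⟩
          d i * 1#                  ≈⟨ *-identityʳ (d i) ⟩
          d i                       ∎
    return (*-cancelʳ-≉0 ℝ (d≉0 i) (begin
      P′ i j * d i  ≈⟨ *-comm _ _ ⟩
      d i * P′ i j  ≈⟨ dP′≈Pd i j ⟩
      P i j * d j   ≈⟨ *-congˡ (harmonic-constant ℝ P-stoch P-sym conn Pd≈d j i) ⟩
      P i j * d i   ∎))
  where
  open RealNumbers ℝ
  open SumProperties semiring using (sum-cong-≋; *-distribˡ-sum)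
  open SetoidReasoning setoid
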